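{- Let $\mathfrak{M}=(W,R,V)$ be an intuitionistic Kripke model. For every formula $\phi$ of the team language and every team $t\subseteq W$, $$\mathfrak{M},t\models\phi\iff\mathfrak{M}^\bullet,t\Vdash\phi^{\boldsymbol{\tau}} .$$
   Context: **Team language and semantics.** Fix a set $\mathsf{Prop}$ of propositional variables. Formulas of the team language are $\phi::=p\mid\bot\mid\phi\wedge\phi\mid\phi\vee\phi\mid\phi\veebar\phi\mid\phi\to\phi$; $\vee$ is the local and $\veebar$ the global disjunction. An intuitionistic Kripke model is $\mathfrak{M}=(W,R,V)$ with $W\neq\varnothing$, $R$ a partial order on $W$, and $V:\mathsf{Prop}\to\wp(W)$ persistent ($w\in V(p)$, $wRv$ imply $v\in V(p)$). A team is a set $t\subseteq W$. For teams, $tR^\circ s$ iff $\forall w\in t\,\exists v\in s\,(wRv)$ and $\forall v\in s\,\exists w\in t\,(wRv)$; $t\supseteq\circ R^\circ s$ iff there is $r\subseteq W$ with $t\supseteq r$ and $rR^\circ s$. Satisfaction: - $\mathfrak{M},t\models p$ iff $t\subseteq V(p)$; - $\mathfrak{M},t\models\bot$ iff $t=\varnothing$; - $\mathfrak{M},t\models\phi\wedge\psi$ iff $\mathfrak{M},t\models\phi$ and $\mathfrak{M},t\models\psi$; - $\mathfrak{M},t\models\phi\vee\psi$ iff there are $s,r\subseteq W$ with $t\subseteq s\cup r$, $\mathfrak{M},s\models\phi$ and $\mathfrak{M},r\models\psi$; - $\mathfrak{M},t\models\phi\veebar\psi$ iff $\mathfrak{M},t\models\phi$ or $\mathfrak{M},t\models\psi$;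 - $\mathfrak{M},t\models\phi\to\psi$ iff for all $s\subseteq W$ with $t\supseteq\circ R^\circ s$, $\mathfrak{M},s\models\phi$ implies $\mathfrak{M},s\models\psi$. **Full powerset model.** $\mathfrak{M}^\bullet=(\wp(W),\supseteq,R^\circ,\cup,\varnothing,V^\circ)$, where $R^\circ$ is the lifting above, $\cup$ is set-theoretic union, and $t\in V^\circ(p)$ iff $t\subseteq V(p)$. **Modal logic $\mathsf{IK}_\otimes$.** Formulas: $\phi::=p\mid\bot\mid\mathbf{0}\mid\phi\wedge\phi\mid\phi\vee\phi\mid\phi\otimes\phi\mid\phi\to\phi\mid\Box\phi$. In a structure $(X,\succcurlyeq,S,\Cup,0,U)$ (here $\mathfrak{M}^\bullet$, with $X=\wp(W)$, $\succcurlyeq$ being $\supseteq$, $S=R^\circ$, $\Cup=\cup$, $0=\varnothing$, $U=V^\circ$; $\preccurlyeq$ is the converse of $\succcurlyeq$), single-world satisfaction is: - $w\Vdash p$ iff $w\in U(p)$; $w\nVdash\bot$ always; $w\Vdash\mathbf{0}$ iff $w=0$; - $w\Vdash\phi\wedge\psi$ iff $w\Vdash\phi$ and $w\Vdash\psi$; $w\Vdash\phi\vee\psi$ iff $w\Vdash\phi$ or $w\Vdash\psi$; - $w\Vdash\phi\otimes\psi$ iff there are $u,v$ with $w\preccurlyeq u\Cup v$, $u\Vdash\phi$ and $v\Vdash\psi$; - $w\Vdash\phi\to\psi$ iff for all $v$ with $w\succcurlyeq v$, $v\Vdash\phi$ implies $v\Vdash\psi$; - $w\Vdash\Box\phi$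 iff for all $u,v$ with $w\succcurlyeq u$ and $uSv$, $v\Vdash\phi$. **Translation** from team formulas to $\mathsf{IK}_\otimes$-formulas: $p^{\boldsymbol{\tau}}=p$, $\bot^{\boldsymbol{\tau}}=\mathbf{0}$, $(\phi\vee\psi)^{\boldsymbol{\tau}}=\phi^{\boldsymbol{\tau}}\otimes\psi^{\boldsymbol{\tau}}$, $(\phi\veebar\psi)^{\boldsymbol{\tau}}=\phi^{\boldsymbol{\tau}}\vee\psi^{\boldsymbol{\tau}}$, $(\phi\wedge\psi)^{\boldsymbol{\tau}}=\phi^{\boldsymbol{\tau}}\wedge\psi^{\boldsymbol{\tau}}$, $(\phi\to\psi)^{\boldsymbol{\tau}}=\Box(\phi^{\boldsymbol{\tau}}\to\psi^{\boldsymbol{\tau}})$. -}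

module Defs where

open import Data.Product using (_×_; ∃-syntax)
open import Data.Sum using (_⊎_)
open import Data.Empty.Polymorphic using (⊥)
open import Function.Base using (flip)
open import Level using (Level; Lift; suc; _⊔_)
open import Relation.Binary.Core using (Rel)
open import Relation.Binary.Structures using (IsPartialOrder)
open import Relation.Binary.PropositionalEquality using (_≡_)
open import Relation.Nullary.Negation using (¬_)
open import Relation.Unary using (Pred; _∈_; _⊆_; _⊇_; _≐_; _∪_)
open import Relation.Unary.Polymorphic using (∅)

private
  variable
    p c ℓ : Level

infixr 7 _∧_
infixr 6 _∨_ _⊻_ _⊗_
infixr 5 _⇒_
infix  8 □_

-- Local disjunction is _∨_, global disjunction is _⊻_.
data TeamFormula (Var : Set p) : Set p where
  var  : Var → TeamFormula Var
  bot  : TeamFormula Var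
  _∧_  : (φ ψ : TeamFormula Var) → TeamFormula Var
  _∨_  : (φ ψ : TeamFormula Var) → TeamFormula Var
  _⊻_  : (φ ψ : TeamFormula Var) → TeamFormula Var
  _⇒_  : (φ ψ : TeamFormula Var) → TeamFormula Var

data ModalFormula (Var : Set p) : Set p where
  var  : Var → ModalFormula Var
  bot  : ModalFormula Var
  𝟎    : ModalFormula Var
  _∧_  : (φ ψ : ModalFormula Var) → ModalFormula Var
  _∨_  : (φ ψ : ModalFormula Var) → ModalFormula Var
  _⊗_  : (φ ψ : ModalFormula Var) → ModalFormula Var
  _⇒_  : (φ ψ : ModalFormula Var) → ModalFormula Var
  □_   : (φ : ModalFormula Var) → ModalFormula Var

-- One universe level ℓ is used for the worlds, the relation, the valuation
-- and the teams, so that predicates W → Set ℓ are closed under first-order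
-- comprehension over W, as the members of ℘(W) are.
record KripkeModel (Var : Set p) (ℓ : Level) : Set (p ⊔ suc ℓ) where
  field
    W              : Set ℓ
    R              : Rel W ℓ
    V              : Var → Pred W ℓ
    nonempty       : ¬ ¬ W
    isPartialOrder : IsPartialOrder _≡_ R
    persistent     : ∀ {q w v} → w ∈ V q → R w v → v ∈ V q

  Team : Set (suc ℓ)
  Team = Pred W ℓ

module TeamSemantics {Var : Set p} (𝔐 : KripkeModel Var ℓ) where
  open KripkeModel 𝔐

  infix 4 _R°_ _⊇∘R°_ _⊨_

  _R°_ : Rel Team ℓ
  t R° s = (∀ w → w ∈ t → ∃[ v ] (v ∈ s × R w v))
         × (∀ v → v ∈ s → ∃[ w ] (w ∈ t × R w v))

  _⊇∘R°_ : Rel Team (suc ℓ)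
  t ⊇∘R° s = ∃[ r ] (t ⊇ r × r R° s)

  -- Equality of teams is extensional equality _≐_ (mutual inclusion).
  _⊨_ : Team → TeamFormula Var → Set (suc ℓ)
  t ⊨ var q   = Lift (suc ℓ) (t ⊆ V q)
  t ⊨ bot     = Lift (suc ℓ) (t ≐ ∅ {ℓ = ℓ})
  t ⊨ (φ ∧ ψ) = t ⊨ φ × t ⊨ ψ
  t ⊨ (φ ∨ ψ) = ∃[ s ] ∃[ r ] (t ⊆ s ∪ r × s ⊨ φ × r ⊨ ψ)
  t ⊨ (φ ⊻ ψ) = t ⊨ φ ⊎ t ⊨ ψ
  t ⊨ (φ ⇒ ψ) = ∀ s → t ⊇∘R° s → s ⊨ φ → s ⊨ ψ

-- _≈_ is the equality of the carrier, needed for the clause "w = 0": in the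
-- powerset structure, sets are predicates and equality is not _≡_.
record ModalStructure (Var : Set p) (c ℓ : Level) : Set (p ⊔ suc (c ⊔ ℓ)) where
  field
    X   : Set c
    _≈_ : Rel X ℓ
    _≽_ : Rel X ℓ
    S   : Rel X ℓ
    _⋓_ : X → X → X
    0#  : X
    U   : Var → Pred X ℓ

  _≼_ : Rel X ℓ
  _≼_ = flip _≽_

module ModalSemantics {Var : Set p} (𝔛 : ModalStructure Var c ℓ) where
  open ModalStructure 𝔛

  infix 4 _⊩_

  _⊩_ : X → ModalFormula Var → Set (c ⊔ ℓ)
  w ⊩ var q   = Lift (c ⊔ ℓ) (w ∈ U q)
  w ⊩ bot     = ⊥
  w ⊩ 𝟎       = Lift (c ⊔ ℓ) (w ≈ 0#)
  w ⊩ (φ ∧ ψ) = w ⊩ φ × w ⊩ ψ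
  w ⊩ (φ ∨ ψ) = w ⊩ φ ⊎ w ⊩ ψ
  w ⊩ (φ ⊗ ψ) = ∃[ u ] ∃[ v ] (w ≼ (u ⋓ v) × u ⊩ φ × v ⊩ ψ)
  w ⊩ (φ ⇒ ψ) = ∀ v → w ≽ v → v ⊩ φ → v ⊩ ψ
  w ⊩ (□ φ)   = ∀ u v → w ≽ u → S u v → v ⊩ φ

infix 9 _•

_• : {Var : Set p} → KripkeModel Var ℓ → ModalStructure Var (suc ℓ) ℓ
𝔐 • = record
  { X   = Team
  ; _≈_ = _≐_
  ; _≽_ = _⊇_
  ; S   = _R°_
  ; _⋓_ = _∪_
  ; 0#  = ∅
  ; U   = λ q t → t ⊆ V q
  }
  where
  open KripkeModel 𝔐
  open TeamSemantics 𝔐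

infix 9 _^τ

_^τ : {Var : Set p} → TeamFormula Var → ModalFormula Var
var q   ^τ = var q
bot     ^τ = 𝟎
(φ ∧ ψ) ^τ = φ ^τ ∧ ψ ^τ
(φ ∨ ψ) ^τ = φ ^τ ⊗ ψ ^τ
(φ ⊻ ψ) ^τ = φ ^τ ∨ ψ ^τ
(φ ⇒ ψ) ^τ = □ (φ ^τ ⇒ ψ ^τ)

infix 4 _∣_⊨_ _∣_⊩_

_∣_⊨_ : {Var : Set p} (𝔐 : KripkeModel Var ℓ) →
        KripkeModel.Team 𝔐 → TeamFormula Var → Set (suc ℓ)
𝔐 ∣ t ⊨ φ = TeamSemantics._⊨_ 𝔐 t φ

_∣_⊩_ : {Var : Set p} (𝔛 : ModalStructure Var c ℓ) →
        ModalStructure.X 𝔛 → ModalFormula Var → Set (c ⊔ ℓ)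
𝔛 ∣ w ⊩ φ = ModalSemantics._⊩_ 𝔛 w φ

{-# OPTIONS --safe #-}
module Submission where

open import Data.Product using (_×_; _,_; ∃-syntax)
open import Data.Product.Function.NonDependent.Propositional using (_×-⇔_)
open import Data.Sum.Function.Propositional using (_⊎-⇔_)
open import Function.Base using (id)
open import Function.Bundles using (_⇔_; mk⇔; module Equivalence)
open import Level using (Level)
open import Relation.Unary using (_∈_; _⊇_)
open import Defs

-- Induction on the formula, for all teams at once. Apart from `⇒`, the clauses on both sides agree
-- in `𝔐 •`. For `⇒`, the modal side reaches teams by `⊇`, then `R°`, then `⊇`, the team side by
-- `⊇`, then `R°`. These composites coincide: `R°-⊇⇒⊇∘R°` moves the last `⊇` in front of `R°`, where
-- transitivity absorbs it; conversely `⊇` is reflexive.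

module _ {p ℓ : Level} {Var : Set p} (𝔐 : KripkeModel Var ℓ) where
  open KripkeModel 𝔐
  open TeamSemantics 𝔐

  -- Keep only the points of `t` that see `s`. Forth then holds by construction, and back holds
  -- because each point of `s` lies in `u` and so has a predecessor in `t`.
  R°-⊇⇒⊇∘R° : ∀ {t u s} → t R° u → u ⊇ s → t ⊇∘R° s
  R°-⊇⇒⊇∘R° {t} {u} {s} (_ , back) u⊇s =
    (λ w → w ∈ t × ∃[ v ] (v ∈ s × R w v)) ,
    (λ (w∈t , _) → w∈t) ,
    (λ w (_ , succ) → succ) ,
    λ v v∈s → let (w , w∈t , wRv) = back v (u⊇s v∈s)
              in w , (w∈t , v , v∈s , wRv) , wRv

  ⊇∘R°-⊇ : ∀ {t u s} → t ⊇ u → u ⊇∘R° s → t ⊇∘R° s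
  ⊇∘R°-⊇ t⊇u (r , u⊇r , rR°s) = r , (λ w∈r → t⊇u (u⊇r w∈r)) , rR°s

-- The modal implication also quantifies over subteams v ⊆ s of an R°-successor
-- s, but by R°-⊇⇒⊇∘R° each such v is already covered by the team implication.
proposition4p12 : ∀ {p ℓ : Level} {Var : Set p} (𝔐 : KripkeModel Var ℓ)
    (φ : TeamFormula Var) (t : KripkeModel.Team 𝔐) →
    (𝔐 ∣ t ⊨ φ) ⇔ (𝔐 • ∣ t ⊩ φ ^τ)
proposition4p12 𝔐 (var q) t = mk⇔ id id
proposition4p12 𝔐 bot     t = mk⇔ id id
proposition4p12 𝔐 (φ ∧ ψ) t = proposition4p12 𝔐 φ t ×-⇔ proposition4p12 𝔐 ψ t
proposition4p12 𝔐 (φ ⊻ ψ) t = proposition4p12 𝔐 φ t ⊎-⇔ proposition4p12 𝔐 ψ t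
proposition4p12 𝔐 (φ ∨ ψ) t = mk⇔
  (λ (s , r , t⊆s∪r , s⊨φ , r⊨ψ) → s , r , t⊆s∪r , φ⇔.to s s⊨φ , ψ⇔.to r r⊨ψ)
  (λ (s , r , t⊆s∪r , s⊩φ , r⊩ψ) → s , r , t⊆s∪r , φ⇔.from s s⊩φ , ψ⇔.from r r⊩ψ)
  where
  module φ⇔ s = Equivalence (proposition4p12 𝔐 φ s)
  module ψ⇔ s = Equivalence (proposition4p12 𝔐 ψ s)
proposition4p12 𝔐 (φ ⇒ ψ) t = mk⇔ to from
  where
  module φ⇔ s = Equivalence (proposition4p12 𝔐 φ s)
  module ψ⇔ s = Equivalence (proposition4p12 𝔐 ψ s)

  to : 𝔐 ∣ t ⊨ (φ ⇒ ψ) → 𝔐 • ∣ t ⊩ (φ ⇒ ψ) ^τ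
  to t⊨φ⇒ψ u s t⊇u uR°s v s⊇v v⊩φ = ψ⇔.to v (t⊨φ⇒ψ v t⊇∘R°v (φ⇔.from v v⊩φ))
    where
    t⊇∘R°v : TeamSemantics._⊇∘R°_ 𝔐 t v
    t⊇∘R°v = ⊇∘R°-⊇ 𝔐 {t} {u} {v} t⊇u (R°-⊇⇒⊇∘R° 𝔐 {u} {s} {v} uR°s s⊇v)

  from : 𝔐 • ∣ t ⊩ (φ ⇒ ψ) ^τ → 𝔐 ∣ t ⊨ (φ ⇒ ψ)
  from t⊩□ s (r , t⊇r , rR°s) s⊨φ = ψ⇔.from s (t⊩□ r s t⊇r rR°s s id (φ⇔.to s s⊨φ))
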